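{- For every integer $d\ge 2$, there exists $\varepsilon>0$ such that the following holds. If $G$ is a graph of maximum average degree at most $d$ and choosability at most $d-1$, and $L$ is a list assignment for $G$ with $|L(v)|\ge d$ for all $v\in V(G)$, then $G$ with the list assignment $L$ is $\varepsilon$-flexible.
   Context: Graphs are finite and simple. The maximum average degree of a graph $G$ is the maximum of $2|E(H)|/|V(H)|$ over all non-null subgraphs $H$ of $G$. A list assignment $L$ for $G$ assigns to each vertex $v\in V(G)$ a finite set $L(v)$ of colors; an $L$-coloring is a proper coloring $\phi$ of $G$ with $\phi(v)\in L(v)$ for all $v\in V(G)$. The choosability of $G$ is the minimum integer $k$ such that $G$ has an $L$-coloring for every assignment $L$ of lists of size at least $k$. A request for $G$ with $L$ is a function $r$ with domain $\mathrm{dom}(r)\subseteq V(G)$ such that $r(v)\in L(v)$ for all $v\in\mathrm{dom}(r)$. For $\varepsilon>0$, a request $r$ is $\varepsilon$-satisfiable if there exists an $L$-coloring $\phi$ of $G$ such that $\phi(v)=r(v)$ for at least $\varepsilon|\mathrm{dom}(r)|$ vertices $v\in\mathrm{dom}(r)$. $G$ with $L$ is $\varepsilon$-flexible if every request is $\varepsilon$-satisfiable. -}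

module Defs where

open import Data.Fin using (Fin)
import Data.Fin.Properties as Fin
open import Data.Fin.Subset using (Subset; ∣_∣) renaming (_∈_ to _∈ₛ_)
open import Data.Integer using (+_)
open import Data.List using (List; length; filter; allFin; cartesianProduct)
open import Data.List.Membership.Propositional using (_∈_)
open import Data.List.Relation.Unary.Unique.Propositional using (Unique)
open import Data.Maybe using (Maybe; just; is-just)
import Data.Maybe.Properties as Maybe
open import Data.Nat using (ℕ; _≤_; NonZero)
import Data.Nat as ℕ
import Data.Nat.Properties as ℕ
open import Data.Product using (Σ-syntax; _×_; _,_)
open import Data.Rational using (ℚ; 0ℚ; _/_)
import Data.Rational as ℚ
open import Data.Sum using (_⊎_)
open import Data.Vec using (tabulate)
open import Level using (0ℓ)
open import Relation.Binary using (Rel; Decidable; Symmetric; Irreflexive)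
open import Relation.Binary.PropositionalEquality using (_≡_; _≢_)
open import Relation.Nullary using (does)
open import Relation.Nullary.Decidable using (_×-dec_)

fromℕ : ℕ → ℚ
fromℕ k = + k / 1

record Graph (n : ℕ) : Set₁ where
  field
    Adj    : Rel (Fin n) 0ℓ
    adj?   : Decidable Adj
    symm   : Symmetric Adj
    irrefl : Irreflexive _≡_ Adj

-- Subgraphs need not be induced.
record Subgraph {n : ℕ} (G : Graph n) : Set₁ where
  open Graph G using (Adj)
  field
    V       : Subset n
    E       : Rel (Fin n) 0ℓ
    E?      : Decidable E
    E-sym   : Symmetric E
    E⇒Adj   : ∀ {u v} → E u v → Adj u v
    E⇒V     : ∀ {u v} → E u v → u ∈ₛ V

  ∣V∣ : ℕ
  ∣V∣ = ∣ V ∣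

  -- Each edge is counted once, at its increasingly ordered pair of ends.
  ∣E∣ : ℕ
  ∣E∣ = length (filter (λ (u , v) → (u Fin.<? v) ×-dec (E? u v))
                       (cartesianProduct (allFin n) (allFin n)))

  averageDegree : .{{NonZero ∣V∣}} → ℚ
  averageDegree = + (2 ℕ.* ∣E∣) / ∣V∣

open Subgraph using (∣V∣; averageDegree)

-- The null graph has no non-null subgraph; its maximum average degree is
-- taken to be 0, so that it is not excluded.
IsMaximumAverageDegree : ∀ {n} → Graph n → ℚ → Set₁
IsMaximumAverageDegree {n} G m =
  ((H : Subgraph G) .{{_ : NonZero (∣V∣ H)}} → averageDegree H ℚ.≤ m)
  × ((Σ[ H ∈ Subgraph G ] Σ[ H≢∅ ∈ NonZero (∣V∣ H) ]
        averageDegree H {{H≢∅}} ≡ m)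
     ⊎ (n ≡ 0 × m ≡ 0ℚ))

-- Any finite set of colors can be numbered, so colors are natural numbers.
Color : Set
Color = ℕ

record ColorSet : Set where
  field
    elements : List Color
    unique   : Unique elements

  size : ℕ
  size = length elements

open ColorSet using (elements; size)

_∈ᶜ_ : Color → ColorSet → Set
c ∈ᶜ S = c ∈ elements S

ListAssignment : ∀ {n} → Graph n → Set
ListAssignment {n} G = Fin n → ColorSet

record Coloring {n : ℕ} (G : Graph n) (L : ListAssignment G) : Set where
  open Graph G using (Adj)
  field
    color  : Fin n → Color
    proper : ∀ {u v} → Adj u v → color u ≢ color v
    inList : ∀ v → color v ∈ᶜ L v

open Coloring using (color)

Choosable : ∀ {n} → Graph n → ℕ → Set
Choosable G k =
  (L : ListAssignment G) → (∀ v → k ≤ size (L v)) → Coloring G L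

IsChoosability : ∀ {n} → Graph n → ℕ → Set
IsChoosability G k = Choosable G k × (∀ j → Choosable G j → k ≤ j)

-- A partial function on the vertices, with value `nothing` off its domain.
record Request {n : ℕ} (G : Graph n) (L : ListAssignment G) : Set where
  field
    request : Fin n → Maybe Color
    inList  : ∀ v {c} → request v ≡ just c → c ∈ᶜ L v

  dom : Subset n
  dom = tabulate (λ v → is-just (request v))

  satisfiedBy : Coloring G L → Subset n
  satisfiedBy φ =
    tabulate (λ v → does (Maybe.≡-dec ℕ._≟_ (request v) (just (color φ v))))

open Request using (dom; satisfiedBy)

Satisfiable : ∀ {n} {G : Graph n} {L : ListAssignment G} →
              ℚ → Request G L → Set
Satisfiable {G = G} {L = L} ε r =
  Σ[ φ ∈ Coloring G L ] ε ℚ.* fromℕ ∣ dom r ∣ ℚ.≤ fromℕ ∣ satisfiedBy r φ ∣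

Flexible : ∀ {n} → ℚ → (G : Graph n) → ListAssignment G → Set
Flexible ε G L = (r : Request G L) → Satisfiable ε r

{-# OPTIONS --safe #-}

-- Let D be the domain of the request. Deleting a vertex outside D of degree
-- less than d is harmless, since it can be colored greedily at the end. When no
-- such vertex is left, the bound on the average degree forces the vertices of D
-- to have average degree at most d, so at least half of them have degree at most
-- 2d, although their neighbours may have unbounded degree. Now every vertex w
-- chooses at random either to take its requested color or to give up one of d
-- colors of its list. A request at x can be met if x chooses to take it and
-- every neighbour w of x gives up a color, leaving at least d - 1 colors other
-- than that of x. These are at most 2d + 1 conditions, each of probability at
-- least 1/(d + 1), so some choice meets at least |D| / (2(d + 1)^(2d + 1))
-- requests, and (d - 1)-choosability colors all other vertices from what is left
-- of their lists.
module Submission where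

open import Defs
open import Data.Bool using (true; false; if_then_else_)
open import Data.Fin using (Fin; zero; suc; punchIn; inject≤; toℕ)
import Data.Fin.Properties as Fin
open import Data.Fin.Properties using (all?; any?; punchIn-injective; punchInᵢ≢i)
open import Data.Fin.Subset using (Subset; ∣_∣; _-_; ⊤; _⊂_)
  renaming (_∈_ to _∈ₛ_; _∉_ to _∉ₛ_; _⊆_ to _⊆ₛ_)
open import Data.Fin.Subset.Induction using (⊂-wellFounded; Acc; acc)
open import Data.Fin.Subset.Properties using (_∈?_; x∈p⇒p-x⊂p; x∈p∧x≢y⇒x∈p-y; ∈⊤)
import Data.Integer as ℤ
import Data.Integer.Properties as ℤ
open import Data.List
  using (List; length; filter; map; _++_; tabulate; cartesianProduct; lookup)
open import Data.List.Membership.Propositional.Properties using (∈-lookup; ∈-tabulate⁻)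
import Data.List.Properties as List
import Data.List.Relation.Unary.All as All
open import Data.List.Relation.Unary.AllPairs using (_∷_)
open import Data.List.Relation.Unary.Unique.Propositional using (Unique)
import Data.List.Relation.Unary.Unique.Propositional.Properties as Unique
open import Data.Maybe using (just; nothing; is-just; fromMaybe)
import Data.Maybe.Properties as Maybe
open import Data.Nat hiding (_/_)
open import Data.Nat.Properties hiding (_≟_)
import Data.Nat.Properties as ℕ
open import Data.Product using (Σ-syntax; ∃-syntax; _×_; _,_; proj₁; proj₂)
open import Data.Rational using (ℚ; 0ℚ; _/_; toℚᵘ) renaming (_≤_ to _≤ℚ_; _<_ to _<ℚ_)
import Data.Rational as ℚ
import Data.Rational.Properties as ℚ
open import Data.Rational.Unnormalised using (mkℚᵘ; *≤*) renaming (_≤_ to _≤ᵘ_)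
import Data.Rational.Unnormalised as ℚᵘ
import Data.Rational.Unnormalised.Properties as ℚᵘ
open import Data.Sum using (_⊎_; inj₁; inj₂)
import Data.Vec as Vec
open import Data.Vec using ([]; _∷_)
open import Data.Vec.Properties using (lookup∘tabulate; []=⇒lookup; lookup⇒[]=)
open import Algebra.Properties.Monoid.Sum *-1-monoid using () renaming (sum to product)
open import Algebra.Properties.Semiring.Sum +-*-semiring
  using (sum; sum-cong-≗; ∑-distrib-+; ∑-comm; *-distribˡ-sum; *-distribʳ-sum)
open import Function using (_∘_; const)
open import Relation.Binary using (tri<; tri≈; tri>)
open import Relation.Binary.PropositionalEquality
open import Relation.Nullary using (Dec; yes; no; does; ¬_; contradiction)
open import Relation.Nullary.Decidable using (_×-dec_; _→-dec_; ¬?; dec-true)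

open ColorSet using (elements; size; unique)
open Graph using (Adj; adj?; symm; irrefl)

private variable
  m n : ℕ
  P Q : Set

-- Indicators, finite sums and products.

𝟙 : Dec P → ℕ
𝟙 P? = if does P? then 1 else 0

𝟙-yes : (P? : Dec P) → P → 𝟙 P? ≡ 1
𝟙-yes (yes _) _ = refl
𝟙-yes (no ¬p) p = contradiction p ¬p

𝟙-no : (P? : Dec P) → ¬ P → 𝟙 P? ≡ 0
𝟙-no (yes p) ¬p = contradiction p ¬p
𝟙-no (no _)  _  = refl

𝟙-mono : (P? : Dec P) (Q? : Dec Q) → (P → Q) → 𝟙 P? ≤ 𝟙 Q?
𝟙-mono (yes p) Q? h = ≤-reflexive (sym (𝟙-yes Q? (h p)))
𝟙-mono (no _)  Q? h = z≤n

𝟙-cong : (P? : Dec P) (Q? : Dec Q) → (P → Q) → (Q → P) → 𝟙 P? ≡ 𝟙 Q?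
𝟙-cong P? Q? h k = ≤-antisym (𝟙-mono P? Q? h) (𝟙-mono Q? P? k)

sum-mono : {f g : Fin n → ℕ} → (∀ i → f i ≤ g i) → sum f ≤ sum g
sum-mono {zero}  h = z≤n
sum-mono {suc n} h = +-mono-≤ (h zero) (sum-mono (h ∘ suc))

sum-mono-< : {f g : Fin (suc n) → ℕ} → (∀ i → f i < g i) → sum f < sum g
sum-mono-< h = +-mono-<-≤ (h zero) (sum-mono (<⇒≤ ∘ h ∘ suc))

term≤sum : (f : Fin n → ℕ) (i : Fin n) → f i ≤ sum f
term≤sum f zero    = m≤m+n _ _
term≤sum f (suc i) = ≤-trans (term≤sum (f ∘ suc) i) (m≤n+m _ (f zero))

sum-const : ∀ n c → sum {n} (const c) ≡ n * c
sum-const zero    c = refl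
sum-const (suc n) c = cong (c +_) (sum-const n c)

sum-𝟙≤1 : {P : Fin n → Set} (P? : ∀ i → Dec (P i)) →
          (∀ {i j} → P i → P j → i ≡ j) → sum (λ i → 𝟙 (P? i)) ≤ 1
sum-𝟙≤1 {zero}  P? h = z≤n
sum-𝟙≤1 {suc n} P? h with P? zero
... | no _  = sum-𝟙≤1 (P? ∘ suc) (λ p q → Fin.suc-injective (h p q))
... | yes p = ≤-reflexive (cong suc (trans (sum-cong-≗ rest) (trans (sum-const n 0) (*-zeroʳ n))))
  where
  rest : ∀ i → 𝟙 (P? (suc i)) ≡ 0
  rest i = 𝟙-no (P? (suc i)) (Fin.0≢1+n ∘ h p)

∣p∣≡sum : (p : Subset n) → ∣ p ∣ ≡ sum (λ v → 𝟙 (v ∈? p))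
∣p∣≡sum []          = refl
∣p∣≡sum (true ∷ p)  = cong suc (∣p∣≡sum p)
∣p∣≡sum (false ∷ p) = ∣p∣≡sum p

product-zero : (f : Fin n → ℕ) (i : Fin n) → f i ≡ 0 → product f ≡ 0
product-zero f zero    eq rewrite eq = refl
product-zero f (suc i) eq rewrite product-zero (f ∘ suc) i eq = *-zeroʳ (f zero)

product≤^sum : ∀ b (f e : Fin n → ℕ) → (∀ i → f i ≤ b ^ e i) → product f ≤ b ^ sum e
product≤^sum {zero}  b f e h = ≤-refl
product≤^sum {suc n} b f e h = begin
  f zero * product (f ∘ suc)     ≤⟨ *-mono-≤ (h zero) (product≤^sum b (f ∘ suc) (e ∘ suc) (h ∘ suc)) ⟩
  b ^ e zero * b ^ sum (e ∘ suc) ≡⟨ ^-distribˡ-+-* b (e zero) _ ⟨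
  b ^ sum e                      ∎
  where open ≤-Reasoning

length-filter-map-tabulate :
  {A B : Set} {P : B → Set} (P? : ∀ b → Dec (P b)) (h : A → B) (f : Fin n → A) →
  length (filter P? (map h (tabulate f))) ≡ sum (λ i → 𝟙 (P? (h (f i))))
length-filter-map-tabulate {zero}  P? h f = refl
length-filter-map-tabulate {suc n} P? h f with does (P? (h (f zero)))
... | true  = cong suc (length-filter-map-tabulate P? h (f ∘ suc))
... | false = length-filter-map-tabulate P? h (f ∘ suc)

-- Turns the edge count of a subgraph, a filtered list of pairs, into a double sum of indicators.
length-filter-pairs :
  {A B : Set} {P : A × B → Set} (P? : ∀ p → Dec (P p)) (f : Fin m → A) (g : Fin n → B) →
  length (filter P? (cartesianProduct (tabulate f) (tabulate g)))
    ≡ sum (λ i → sum (λ j → 𝟙 (P? (f i , g j))))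
length-filter-pairs {zero}  P? f g = refl
length-filter-pairs {suc m} P? f g = begin
  length (filter P? (row ++ rest))                   ≡⟨ cong length (List.filter-++ P? row rest) ⟩
  length (filter P? row ++ filter P? rest)           ≡⟨ List.length-++ (filter P? row) ⟩
  length (filter P? row) + length (filter P? rest)   ≡⟨ cong₂ _+_ (length-filter-map-tabulate P? (f zero ,_) g)
                                                                 (length-filter-pairs P? (f ∘ suc) g) ⟩
  sum (λ i → sum (λ j → 𝟙 (P? (f i , g j))))         ∎
  where
  open ≡-Reasoning
  row  = map (f zero ,_) (tabulate g)
  rest = cartesianProduct (tabulate (f ∘ suc)) (tabulate g)

-- Averaging and derandomization.

max-term : ∀ s (h : Fin (suc m) → ℕ) → suc m * s ≤ sum h → ∃[ i ] s ≤ h i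
max-term {m} s h le with any? (λ i → s ≤? h i)
... | yes found = found
... | no none   = contradiction le (<⇒≱ (subst (sum h <_) (sum-const (suc m) s)
                    (sum-mono-< (λ i → ≰⇒> (λ s≤hi → none (i , s≤hi))))))

-- The method of conditional expectations: for uniformly random f, the factors
-- a w (f w) x are independent and have mean at least 1.
derandomize : ∀ {k} n (ω : Fin k → ℕ) (a : Fin n → Fin (suc m) → Fin k → ℕ) →
  (∀ w x → suc m ≤ sum (λ i → a w i x)) →
  Σ[ f ∈ (Fin n → Fin (suc m)) ] sum ω ≤ sum (λ x → ω x * product (λ w → a w (f w) x))
derandomize zero ω a h = (λ ()) , ≤-reflexive (sum-cong-≗ (λ x → sym (*-identityʳ (ω x))))
derandomize {m} (suc n) ω a h = f , ≤-trans s≤ (≤-trans IH (≤-reflexive (sum-cong-≗ assoc)))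
  where
  averaged : suc m * sum ω ≤ sum (λ i → sum (λ x → ω x * a zero i x))
  averaged = begin
    suc m * sum ω                            ≡⟨ *-comm (suc m) (sum ω) ⟩
    sum ω * suc m                            ≡⟨ *-distribʳ-sum (suc m) ω ⟩
    sum (λ x → ω x * suc m)                  ≤⟨ sum-mono (λ x → *-monoʳ-≤ (ω x) (h zero x)) ⟩
    sum (λ x → ω x * sum (λ i → a zero i x)) ≡⟨ sum-cong-≗ (λ x → *-distribˡ-sum (ω x) (λ i → a zero i x)) ⟩
    sum (λ x → sum (λ i → ω x * a zero i x)) ≡⟨ ∑-comm (λ x i → ω x * a zero i x) ⟩
    sum (λ i → sum (λ x → ω x * a zero i x)) ∎
    where open ≤-Reasoning
  best = max-term (sum ω) (λ i → sum (λ x → ω x * a zero i x)) averaged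
  i₀ = proj₁ best
  s≤ = proj₂ best
  -- Fixing the first choice multiplies its factor into the weights; the induction therefore needs
  -- arbitrary weights.
  later = derandomize n (λ x → ω x * a zero i₀ x) (a ∘ suc) (h ∘ suc)
  IH = proj₂ later
  f : Fin (suc n) → Fin (suc m)
  f zero    = i₀
  f (suc w) = proj₁ later w
  assoc : ∀ x → ω x * a zero i₀ x * product (λ w → a (suc w) (proj₁ later w) x)
              ≡ ω x * product (λ w → a w (f w) x)
  assoc x = *-assoc (ω x) _ _

-- Choosing colors from lists.

-- Double counting of the pairs of a color `c k` and a vertex of `P` colored with it. If no color
-- were free, each of the `d` colors would occur in a pair, while injectivity of `c` leaves each
-- vertex in at most one.
free-color : ∀ {d} {P : Fin n → Set} (P? : ∀ v → Dec (P v)) (φ : Fin n → Color)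
  (c : Fin d → Color) → (∀ {i j} → c i ≡ c j → i ≡ j) →
  sum (λ v → 𝟙 (P? v)) < d → ∃[ k ] (∀ v → P v → φ v ≢ c k)
free-color {n} {d} {P} P? φ c c-inj few
  with any? (λ k → all? (λ v → P? v →-dec ¬? (φ v ℕ.≟ c k)))
... | yes found = found
... | no none   = contradiction few (≤⇒≯ d≤)
  where
  Used? : ∀ k v → Dec (P v × φ v ≡ c k)
  Used? k v = P? v ×-dec (φ v ℕ.≟ c k)

  used : ∀ k → 1 ≤ sum (λ v → 𝟙 (Used? k v))
  used k with any? (Used? k)
  ... | yes (v , u) = ≤-trans (≤-reflexive (sym (𝟙-yes (Used? k v) u))) (term≤sum _ v)
  ... | no unused   = contradiction (k , λ v p eq → unused (v , p , eq)) none

  once : ∀ v → sum (λ k → 𝟙 (Used? k v)) ≤ 𝟙 (P? v)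
  once v with P? v
  ... | yes p = sum-𝟙≤1 (λ k → yes p ×-dec (φ v ℕ.≟ c k)) (λ (_ , x) (_ , y) → c-inj (trans (sym x) y))
  ... | no _  = ≤-reflexive (trans (sum-const d 0) (*-zeroʳ d))

  d≤ : d ≤ sum (λ v → 𝟙 (P? v))
  d≤ = begin
    d                                      ≡⟨ *-identityʳ d ⟨
    d * 1                                  ≡⟨ sum-const d 1 ⟨
    sum {d} (const 1)                      ≤⟨ sum-mono used ⟩
    sum (λ k → sum (λ v → 𝟙 (Used? k v)))  ≡⟨ ∑-comm (λ k v → 𝟙 (Used? k v)) ⟩
    sum (λ v → sum (λ k → 𝟙 (Used? k v)))  ≤⟨ sum-mono once ⟩
    sum (λ v → 𝟙 (P? v))                   ∎
    where open ≤-Reasoning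

lookup-injective : {A : Set} {xs : List A} → Unique xs → ∀ i j → lookup xs i ≡ lookup xs j → i ≡ j
lookup-injective (x∉ ∷ u) zero    zero    eq = refl
lookup-injective (x∉ ∷ u) zero    (suc j) eq = contradiction eq (All.lookup x∉ (∈-lookup j))
lookup-injective (x∉ ∷ u) (suc i) zero    eq = contradiction (sym eq) (All.lookup x∉ (∈-lookup i))
lookup-injective (x∉ ∷ u) (suc i) (suc j) eq = cong suc (lookup-injective u i j eq)

override : {P : Fin n → Set} → (∀ v → Dec (P v)) → (f g : Fin n → Color) → Fin n → Color
override P? f g v = if does (P? v) then f v else g v

override-view : {P : Fin n → Set} (P? : ∀ v → Dec (P v)) (f g : Fin n → Color) → ∀ v →
  (P v × override P? f g v ≡ f v) ⊎ (¬ P v × override P? f g v ≡ g v)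
override-view P? f g v with P? v
... | yes p = inj₁ (p , refl)
... | no ¬p = inj₂ (¬p , refl)

-- Indexing `d` colors of a list by `Fin d` lets both a greedy choice and the surrender of a color
-- be the choice of an index.
module FirstColors {d} (S : ColorSet) (d≤ : d ≤ size S) where

  nth : Fin d → Color
  nth k = lookup (elements S) (inject≤ k d≤)

  nth-injective : ∀ {i j} → nth i ≡ nth j → i ≡ j
  nth-injective {i} {j} eq =
    Fin.inject≤-injective d≤ d≤ i j (lookup-injective (unique S) _ _ eq)

  nth∈ : ∀ k → nth k ∈ᶜ S
  nth∈ k = ∈-lookup (inject≤ k d≤)

-- Degrees within a vertex set and the handshake identity.

module _ (G : Graph n) where

  Neighbour : Subset n → Fin n → Fin n → Set
  Neighbour Z x w = Adj G w x × w ∈ₛ Z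

  neighbour? : ∀ Z x w → Dec (Neighbour Z x w)
  neighbour? Z x w = adj? G w x ×-dec (w ∈? Z)

  deg : Subset n → Fin n → ℕ
  deg Z x = sum (λ w → 𝟙 (neighbour? Z x w))

  induced : Subset n → Subgraph G
  induced Z = record
    { V     = Z
    ; E     = λ u v → u ∈ₛ Z × Neighbour Z u v
    ; E?    = λ u v → (u ∈? Z) ×-dec neighbour? Z u v
    ; E-sym = λ (u∈Z , vu , v∈Z) → v∈Z , symm G vu , u∈Z
    ; E⇒Adj = λ (_ , vu , _) → symm G vu
    ; E⇒V   = proj₁
    }

  -- Each ordered pair of adjacent vertices of `Z` is increasing in exactly one of its two orders,
  -- since no vertex is adjacent to itself. Summing over both orders counts each edge twice.
  handshake : ∀ Z → sum (λ u → 𝟙 (u ∈? Z) * deg Z u) ≡ 2 * Subgraph.∣E∣ (induced Z)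
  handshake Z = begin
    sum (λ u → 𝟙 (u ∈? Z) * deg Z u)
      ≡⟨ sum-cong-≗ (λ u → trans (*-distribˡ-sum (𝟙 (u ∈? Z)) (λ v → 𝟙 (neighbour? Z u v))) (sum-cong-≗ (split u))) ⟩
    sum (λ u → sum (λ v → up u v + up v u))
      ≡⟨ sum-cong-≗ (λ u → ∑-distrib-+ (up u) (λ v → up v u)) ⟩
    sum (λ u → sum (up u) + sum (λ v → up v u))
      ≡⟨ ∑-distrib-+ (λ u → sum (up u)) (λ u → sum (λ v → up v u)) ⟩
    sum (λ u → sum (up u)) + sum (λ u → sum (λ v → up v u))
      ≡⟨ cong₂ _+_ (sym edges) (trans (sym (∑-comm up)) (sym edges)) ⟩
    Subgraph.∣E∣ H + Subgraph.∣E∣ H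
      ≡⟨ cong (Subgraph.∣E∣ H +_) (+-identityʳ _) ⟨
    2 * Subgraph.∣E∣ H ∎
    where
    open ≡-Reasoning
    H = induced Z
    E? = Subgraph.E? H
    Up? : ∀ u v → Dec (toℕ u < toℕ v × Subgraph.E H u v)
    Up? u v = (u Fin.<? v) ×-dec E? u v
    up : Fin n → Fin n → ℕ
    up u v = 𝟙 (Up? u v)

    edges : Subgraph.∣E∣ H ≡ sum (λ u → sum (up u))
    edges = length-filter-pairs (λ (u , v) → Up? u v) (λ u → u) (λ v → v)

    product-𝟙 : ∀ u v → 𝟙 (u ∈? Z) * 𝟙 (neighbour? Z u v) ≡ 𝟙 (E? u v)
    product-𝟙 u v with u ∈? Z
    ... | yes _ = +-identityʳ _
    ... | no _  = refl

    split : ∀ u v → 𝟙 (u ∈? Z) * 𝟙 (neighbour? Z u v) ≡ up u v + up v u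
    split u v = trans (product-𝟙 u v) (oriented (Fin.<-cmp u v))
      where
      oriented : _ → 𝟙 (E? u v) ≡ up u v + up v u
      oriented (tri< u<v _ v≮u) = sym (trans
        (cong₂ _+_ (𝟙-cong (Up? u v) (E? u v) proj₂ (u<v ,_)) (𝟙-no (Up? v u) (v≮u ∘ proj₁)))
        (+-identityʳ _))
      oriented (tri> u≮v _ v<u) = sym
        (cong₂ _+_ (𝟙-no (Up? u v) (u≮v ∘ proj₁))
                   (𝟙-cong (Up? v u) (E? u v) (Subgraph.E-sym H ∘ proj₂) (λ e → v<u , Subgraph.E-sym H e)))
      oriented (tri≈ u≮v refl v≮u) = trans (𝟙-no (E? u u) (λ e → irrefl G refl (Subgraph.E⇒Adj H e)))
        (sym (cong₂ _+_ (𝟙-no (Up? u u) (u≮v ∘ proj₁)) (𝟙-no (Up? u u) (v≮u ∘ proj₁))))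

  -- Partial colorings and their greedy extension.

  -- The colors outside Z are arbitrary.
  record PartialColoring (L : ListAssignment G) (Z : Subset n) : Set where
    field
      color  : Fin n → Color
      proper : ∀ {u v} → u ∈ₛ Z → v ∈ₛ Z → Adj G u v → color u ≢ color v
      inList : ∀ {v} → v ∈ₛ Z → color v ∈ᶜ L v

  open PartialColoring

  -- The neighbours of `w` in `Z` block fewer than `d` colors. Agreement away from `w` is recorded
  -- so that requests already satisfied elsewhere stay so.
  extend : ∀ {d L Z w} → w ∈ₛ Z → deg Z w < d → d ≤ size (L w) →
           (φ : PartialColoring L (Z - w)) →
           Σ[ ψ ∈ PartialColoring L Z ] (∀ v → v ≢ w → color ψ v ≡ color φ v)
  extend {d} {L} {Z} {w} w∈Z deg<d d≤ φ = ψ , away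
    where
    open FirstColors (L w) d≤
    free = free-color (neighbour? Z w) (color φ) nth nth-injective deg<d
    c = nth (proj₁ free)
    avoids : ∀ v → Neighbour Z w v → color φ v ≢ c
    avoids = proj₂ free
    new : Fin n → Color
    new = override (Fin._≟ w) (const c) (color φ)
    view = override-view (Fin._≟ w) (const c) (color φ)
    away : ∀ v → v ≢ w → new v ≡ color φ v
    away v v≢w with view v
    ... | inj₁ (v≡w , _) = contradiction v≡w v≢w
    ... | inj₂ (_ , eq)  = eq
    new-proper : ∀ {u v} → u ∈ₛ Z → v ∈ₛ Z → Adj G u v → new u ≢ new v
    new-proper {u} {v} u∈Z v∈Z uv eq with view u | view v
    ... | inj₁ (refl , _)  | inj₁ (refl , _)  = irrefl G refl uv
    ... | inj₁ (refl , eu) | inj₂ (_ , ev)    = avoids v (symm G uv , v∈Z) (trans (sym ev) (trans (sym eq) eu))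
    ... | inj₂ (_ , eu)    | inj₁ (refl , ev) = avoids u (uv , u∈Z) (trans (sym eu) (trans eq ev))
    ... | inj₂ (u≢w , eu)  | inj₂ (v≢w , ev)  =
      proper φ (x∈p∧x≢y⇒x∈p-y u∈Z u≢w) (x∈p∧x≢y⇒x∈p-y v∈Z v≢w) uv (trans (sym eu) (trans eq ev))
    new-inList : ∀ {v} → v ∈ₛ Z → new v ∈ᶜ L v
    new-inList {v} v∈Z with view v
    ... | inj₁ (refl , eq) = subst (_∈ᶜ L v) (sym eq) (nth∈ (proj₁ free))
    ... | inj₂ (v≢w , eq)  = subst (_∈ᶜ L v) (sym eq) (inList φ (x∈p∧x≢y⇒x∈p-y v∈Z v≢w))
    ψ : PartialColoring L Z
    ψ = record { color = new ; proper = new-proper ; inList = new-inList }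

  -- Random choices for a fixed request.

  module _ {k} (choosable : Choosable G k)
           (L : ListAssignment G) (large : ∀ v → suc k ≤ size (L v))
           (D : Subset n) (ρ : Fin n → Color) (ρ∈L : ∀ {v} → v ∈ₛ D → ρ v ∈ᶜ L v) where

    private d = suc k

    -- `b` is the number of choices at a vertex. A vertex of degree at most `2 * d` faces at most
    -- `suc (2 * d)` conditions, each met by at least one choice in `b`, which gives `M`.
    b M : ℕ
    b = suc d
    M = b ^ suc (2 * d)

    Satisfied? : (φ : Fin n → Color) → ∀ v → Dec (v ∈ₛ D × φ v ≡ ρ v)
    Satisfied? φ v = (v ∈? D) ×-dec (φ v ℕ.≟ ρ v)

    #satisfied : (Fin n → Color) → ℕ
    #satisfied φ = sum (λ v → 𝟙 (Satisfied? φ v))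

    module Palette (v : Fin n) = FirstColors (L v) (large v)

    -- `punchIn j` skips the index `j`, so exactly `k` colors remain, as many as choosability asks
    -- for.
    residual : Fin n → Fin d → ColorSet
    residual v j = record
      { elements = tabulate (Palette.nth v ∘ punchIn j)
      ; unique   = Unique.tabulate⁺ (λ eq → punchIn-injective j _ _ (Palette.nth-injective v eq))
      }

    residual⊆L : ∀ v j {c} → c ∈ᶜ residual v j → c ∈ᶜ L v
    residual⊆L v j c∈ with i , refl ← ∈-tabulate⁻ c∈ = Palette.nth∈ v (punchIn j i)

    -- If `c` is one of the `d` indexed colors, its index is given up; otherwise any index will do.
    avoidable : ∀ v c → ∃[ j ] (∀ i → c ≢ Palette.nth v (punchIn j i))
    avoidable v c with any? (λ j → c ℕ.≟ Palette.nth v j)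
    ... | yes (j , refl) = j , λ i eq → punchInᵢ≢i j i (sym (Palette.nth-injective v eq))
    ... | no absent      = zero , λ i eq → absent (_ , eq)

    module _ (Z : Subset n) where

      -- Whether choice i at w lets x take its requested color: zero means that w
      -- takes its own requested color, suc j that w gives up its j-th color.
      Compatible : Fin n → Fin b → Fin n → Set
      Compatible w zero    x = ¬ Neighbour Z x w
      Compatible w (suc j) x =
        w ≢ x × (Neighbour Z x w → ∀ i → ρ x ≢ Palette.nth w (punchIn j i))

      compatible? : ∀ w i x → Dec (Compatible w i x)
      compatible? w zero    x = ¬? (neighbour? Z x w)
      compatible? w (suc j) x = ¬? (w Fin.≟ x) ×-dec
        (neighbour? Z x w →-dec all? (λ i → ¬? (ρ x ℕ.≟ Palette.nth w (punchIn j i))))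

      constraints : Fin n → Fin n → ℕ
      constraints x w = 𝟙 (w Fin.≟ x) + 𝟙 (neighbour? Z x w)

      -- The indicator of compatibility, rescaled by the inverse of the least probability it can
      -- have, so that its mean is at least 1.
      gain : Fin n → Fin b → Fin n → ℕ
      gain w i x = 𝟙 (compatible? w i x) * b ^ constraints x w

      gain-compatible : ∀ {w i x} → Compatible w i x → gain w i x ≡ b ^ constraints x w
      gain-compatible {w} {i} {x} c = trans (cong (_* _) (𝟙-yes (compatible? w i x) c)) (*-identityˡ _)

      -- If `w` is `x` or a neighbour of `x`, one compatible choice already contributes at least
      -- `b`: taking the request, or giving up the color requested at `x`. Otherwise all `b` choices
      -- are compatible and contribute at least 1 each.
      gain-total : ∀ w x → b ≤ sum (λ i → gain w i x)
      gain-total w x = by-cases (w Fin.≟ x) (neighbour? Z x w)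
        where
        one : ∀ i → 1 ≤ constraints x w → Compatible w i x → b ≤ sum (λ i → gain w i x)
        one i 1≤e c = begin
          b                      ≡⟨ ^-identityʳ b ⟨
          b ^ 1                  ≤⟨ ^-monoʳ-≤ b 1≤e ⟩
          b ^ constraints x w    ≡⟨ gain-compatible {w} {i} {x} c ⟨
          gain w i x             ≤⟨ term≤sum (λ i → gain w i x) i ⟩
          sum (λ i → gain w i x) ∎
          where open ≤-Reasoning
        by-cases : Dec (w ≡ x) → Dec (Neighbour Z x w) → b ≤ sum (λ i → gain w i x)
        by-cases (yes refl) _ =
          one zero (≤-trans (≤-reflexive (sym (𝟙-yes (w Fin.≟ w) refl))) (m≤m+n _ _))
            (irrefl G refl ∘ proj₁)
        by-cases (no w≢x) (yes nb) =
          one (suc (proj₁ (avoidable w (ρ x))))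
            (≤-trans (≤-reflexive (sym (𝟙-yes (neighbour? Z x w) nb))) (m≤n+m _ _))
            (w≢x , λ _ → proj₂ (avoidable w (ρ x)))
        by-cases (no w≢x) (no ¬nb) = begin
          b                      ≡⟨ *-identityʳ b ⟨
          b * 1                  ≡⟨ sum-const b 1 ⟨
          sum {b} (const 1)      ≤⟨ sum-mono each ⟩
          sum (λ i → gain w i x) ∎
          where
          open ≤-Reasoning
          each : ∀ i → 1 ≤ gain w i x
          each i = ≤-trans (m^n>0 b (constraints x w)) (≤-reflexive (sym (gain-compatible {w} {i} {x} (free i))))
            where
            free : ∀ i → Compatible w i x
            free zero    = ¬nb
            free (suc j) = w≢x , λ nb → contradiction nb ¬nb

      Low? : ∀ x → Dec (x ∈ₛ D × deg Z x ≤ 2 * d)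
      Low? x = (x ∈? D) ×-dec (deg Z x ≤? 2 * d)

      module _ (f : Fin n → Fin b) where

        Survives? : ∀ x → Dec (∀ w → Compatible w (f w) x)
        Survives? x = all? (λ w → compatible? w (f w) x)

        Kept? : ∀ x → Dec ((x ∈ₛ D × deg Z x ≤ 2 * d) × (∀ w → Compatible w (f w) x))
        Kept? x = Low? x ×-dec Survives? x

        -- A single incompatible choice makes the product vanish. If all are compatible, the
        -- exponents add up to at most 1 for `x` itself plus its degree in `Z`.
        product-gain≤ : ∀ x → 𝟙 (Low? x) * product (λ w → gain w (f w) x) ≤ 𝟙 (Kept? x) * M
        product-gain≤ x = by-cases (Low? x) (Survives? x)
          where
          open ≤-Reasoning
          by-cases : (l : Dec (x ∈ₛ D × deg Z x ≤ 2 * d)) (s : Dec (∀ w → Compatible w (f w) x)) →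
            𝟙 l * product (λ w → gain w (f w) x) ≤ 𝟙 (l ×-dec s) * M
          by-cases (no _) s = z≤n
          by-cases (yes _) (no dies)
            with w , bad ← Fin.¬∀⟶∃¬ n _ (λ w → compatible? w (f w) x) dies = ≤-reflexive
              (trans (+-identityʳ _) (product-zero (λ w → gain w (f w) x) w
                (cong (_* _) (𝟙-no (compatible? w (f w) x) bad))))
          by-cases (yes (_ , low)) (yes s) = +-monoˡ-≤ 0 (begin
            product (λ w → gain w (f w) x)
              ≤⟨ product≤^sum b _ (constraints x) (λ w → ≤-reflexive (gain-compatible {w} {f w} {x} (s w))) ⟩
            b ^ sum (constraints x)
              ≤⟨ ^-monoʳ-≤ b (begin
                   sum (constraints x)                          ≡⟨ ∑-distrib-+ (λ w → 𝟙 (w Fin.≟ x)) _ ⟩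
                   sum (λ w → 𝟙 (w Fin.≟ x)) + deg Z x          ≤⟨ +-mono-≤ (sum-𝟙≤1 (Fin._≟ x) (λ p q → trans p (sym q))) low ⟩
                   suc (2 * d)                                  ∎) ⟩
            M ∎)

        -- A vertex that chose its request need not be kept, and must then be colored from a
        -- residual list as well; it gives up the arbitrary index `zero`.
        reserved : Fin b → Fin d
        reserved zero    = zero
        reserved (suc j) = j

        ψ : Coloring G (λ v → residual v (reserved (f v)))
        ψ = choosable _ (λ v → ≤-reflexive (sym (List.length-tabulate _)))

        -- Choosability colors all of `G` at once, so the kept vertices are colored too and then
        -- overwritten.
        mixed : Fin n → Color
        mixed = override Kept? ρ (Coloring.color ψ)
        view = override-view Kept? ρ (Coloring.color ψ)

        -- Compatibility of `u` with its own choice forces that choice to be `zero`, and `zero` at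
        -- `u` rules out every neighbour of `u`.
        kept-not-adjacent : ∀ {u v} → u ∈ₛ Z → Adj G u v →
          (∀ w → Compatible w (f w) u) → ¬ (∀ w → Compatible w (f w) v)
        kept-not-adjacent {u} u∈Z uv su sv with f u | su u | sv u
        ... | zero  | _         | ¬nb = ¬nb (uv , u∈Z)
        ... | suc _ | u≢u , _   | _   = u≢u refl

        -- As a neighbour of `u` in `Z`, `v` cannot have chosen `zero`; it gave up a color, and what
        -- is left of its list misses `ρ u`.
        ρ≢ψ : ∀ {u v} → v ∈ₛ Z → Adj G v u → (∀ w → Compatible w (f w) u) → ρ u ≢ Coloring.color ψ v
        ρ≢ψ {u} {v} v∈Z vu su eq with f v | su v | Coloring.inList ψ v
        ... | zero  | ¬nb     | _  = ¬nb (vu , v∈Z)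
        ... | suc j | _ , out | c∈ with i , eq′ ← ∈-tabulate⁻ c∈ = out (vu , v∈Z) i (trans eq eq′)

        mixedColoring : PartialColoring L Z
        mixedColoring = record { color = mixed ; proper = mixed-proper ; inList = λ {v} _ → mixed-inList v }
          where
          mixed-proper : ∀ {u v} → u ∈ₛ Z → v ∈ₛ Z → Adj G u v → mixed u ≢ mixed v
          mixed-proper {u} {v} u∈Z v∈Z uv eq with view u | view v
          ... | inj₁ ((_ , su) , _)  | inj₁ ((_ , sv) , _)  = kept-not-adjacent u∈Z uv su sv
          ... | inj₁ ((_ , su) , eu) | inj₂ (_ , ev)        = ρ≢ψ v∈Z (symm G uv) su (trans (sym eu) (trans eq ev))
          ... | inj₂ (_ , eu)        | inj₁ ((_ , sv) , ev) = ρ≢ψ u∈Z uv sv (trans (sym ev) (trans (sym eq) eu))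
          ... | inj₂ (_ , eu)        | inj₂ (_ , ev)        = Coloring.proper ψ uv (trans (sym eu) (trans eq ev))
          mixed-inList : ∀ v → mixed v ∈ᶜ L v
          mixed-inList v with view v
          ... | inj₁ (((v∈D , _) , _) , eq) = subst (_∈ᶜ L v) (sym eq) (ρ∈L v∈D)
          ... | inj₂ (_ , eq)               = subst (_∈ᶜ L v) (sym eq) (residual⊆L v _ (Coloring.inList ψ v))

        kept≤satisfied : ∀ v → 𝟙 (Kept? v) ≤ 𝟙 (Satisfied? mixed v)
        kept≤satisfied v = 𝟙-mono (Kept? v) (Satisfied? mixed v) (λ kept → proj₁ (proj₁ kept) , mixed-kept kept)
          where
          mixed-kept : _ → mixed v ≡ ρ v
          mixed-kept kept with view v
          ... | inj₁ (_ , eq)    = eq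
          ... | inj₂ (¬kept , _) = contradiction kept ¬kept

      -- With the indicator of `Low?` as the initial weight, the total weight is the number of low
      -- vertices, and each kept one accounts for at most `M` of it.
      colorLow : Σ[ φ ∈ PartialColoring L Z ] sum (λ x → 𝟙 (Low? x)) ≤ M * #satisfied (color φ)
      colorLow with f , le ← derandomize n (λ x → 𝟙 (Low? x)) gain gain-total = mixedColoring f , (begin
        sum (λ x → 𝟙 (Low? x))                                         ≤⟨ le ⟩
        sum (λ x → 𝟙 (Low? x) * product (λ w → gain w (f w) x))        ≤⟨ sum-mono (product-gain≤ f) ⟩
        sum (λ x → 𝟙 (Kept? f x) * M)                                  ≤⟨ sum-mono (λ x → *-monoˡ-≤ M (kept≤satisfied f x)) ⟩
        sum (λ x → 𝟙 (Satisfied? (mixed f) x) * M)                     ≡⟨ *-distribʳ-sum M (λ x → 𝟙 (Satisfied? (mixed f) x)) ⟨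
        #satisfied (mixed f) * M                                       ≡⟨ *-comm _ M ⟩
        M * #satisfied (mixed f)                                       ∎)
        where open ≤-Reasoning

      -- Low-degree vertices of the request when no deletion is possible.

      module _ (D⊆Z : D ⊆ₛ Z) (sparse : sum (λ v → 𝟙 (v ∈? Z) * deg Z v) ≤ d * ∣ Z ∣)
               (stuck : ∀ {v} → v ∈ₛ Z → v ∉ₛ D → d ≤ deg Z v) where

        -- Markov's inequality for the degrees of D, with d * ∣ Z ∣ added on both sides.
        ∣D∣≤2low : ∣ D ∣ ≤ 2 * sum (λ x → 𝟙 (Low? x))
        ∣D∣≤2low = *-cancelˡ-≤ d (+-cancelˡ-≤ (d * ∣ Z ∣) _ _ (begin
          d * ∣ Z ∣ + d * ∣ D ∣                                         ≡⟨ cong₂ _+_ (scaled Z) (scaled D) ⟩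
          sum (λ v → d * 𝟙 (v ∈? Z)) + sum (λ v → d * 𝟙 (v ∈? D))       ≡⟨ ∑-distrib-+ (λ v → d * 𝟙 (v ∈? Z)) (λ v → d * 𝟙 (v ∈? D)) ⟨
          sum (λ v → d * 𝟙 (v ∈? Z) + d * 𝟙 (v ∈? D))                   ≤⟨ sum-mono (λ v → pointwise v (v ∈? Z) (v ∈? D) (deg Z v ≤? 2 * d)) ⟩
          sum (λ v → 𝟙 (v ∈? Z) * deg Z v + 2 * d * 𝟙 (Low? v))         ≡⟨ ∑-distrib-+ (λ v → 𝟙 (v ∈? Z) * deg Z v) _ ⟩
          sum (λ v → 𝟙 (v ∈? Z) * deg Z v) + sum (λ v → 2 * d * 𝟙 (Low? v)) ≡⟨ cong (_ +_) (*-distribˡ-sum (2 * d) (λ v → 𝟙 (Low? v))) ⟨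
          sum (λ v → 𝟙 (v ∈? Z) * deg Z v) + 2 * d * low                ≤⟨ +-monoˡ-≤ _ sparse ⟩
          d * ∣ Z ∣ + 2 * d * low                                       ≡⟨ cong (d * ∣ Z ∣ +_) (trans (cong (_* low) (*-comm 2 d)) (*-assoc d 2 low)) ⟩
          d * ∣ Z ∣ + d * (2 * low)                                     ∎))
          where
          open ≤-Reasoning
          low = sum (λ x → 𝟙 (Low? x))
          scaled : ∀ p → d * ∣ p ∣ ≡ sum (λ v → d * 𝟙 (v ∈? p))
          scaled p = trans (cong (d *_) (∣p∣≡sum p)) (*-distribˡ-sum d (λ v → 𝟙 (v ∈? p)))
          -- A vertex of `Z` outside `D` pays `d` by its degree, since nothing can be deleted. A
          -- vertex of `D` must pay `2 * d`: by its degree if that is high, by the last term if it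
          -- is low.
          pointwise : ∀ v (z : Dec (v ∈ₛ Z)) (x : Dec (v ∈ₛ D)) (l : Dec (deg Z v ≤ 2 * d)) →
            d * 𝟙 z + d * 𝟙 x ≤ 𝟙 z * deg Z v + 2 * d * 𝟙 (x ×-dec l)
          pointwise v (no v∉Z) (yes v∈D) l = contradiction (D⊆Z v∈D) v∉Z
          pointwise v (no _)   (no _)    l = begin
            d * 0 + d * 0     ≡⟨ cong₂ _+_ (*-zeroʳ d) (*-zeroʳ d) ⟩
            0                 ≤⟨ z≤n ⟩
            2 * d * 0         ∎
          pointwise v (yes v∈Z) (no v∉D) l = begin
            d * 1 + d * 0             ≡⟨ cong₂ _+_ (*-identityʳ d) (*-zeroʳ d) ⟩
            d + 0                     ≤⟨ +-mono-≤ (stuck v∈Z v∉D) z≤n ⟩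
            deg Z v + 2 * d * 0       ≡⟨ cong (_+ 2 * d * 0) (*-identityˡ (deg Z v)) ⟨
            1 * deg Z v + 2 * d * 0   ∎
          pointwise v (yes v∈Z) (yes v∈D) (yes _) = begin
            d * 1 + d * 1             ≡⟨ *-distribʳ-+ 1 d d ⟨
            (d + d) * 1               ≡⟨ cong (λ e → (d + e) * 1) (+-identityʳ d) ⟨
            2 * d * 1                 ≤⟨ m≤n+m _ _ ⟩
            1 * deg Z v + 2 * d * 1   ∎
          pointwise v (yes v∈Z) (yes v∈D) (no high) = begin
            d * 1 + d * 1             ≡⟨ *-distribʳ-+ 1 d d ⟨
            (d + d) * 1               ≡⟨ *-identityʳ (d + d) ⟩
            d + d                     ≡⟨ cong (d +_) (+-identityʳ d) ⟨
            2 * d                     ≤⟨ <⇒≤ (≰⇒> high) ⟩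
            deg Z v                   ≡⟨ *-identityˡ (deg Z v) ⟨
            1 * deg Z v               ≤⟨ m≤m+n _ _ ⟩
            1 * deg Z v + 2 * d * 0   ∎

        colorStuck : Σ[ φ ∈ PartialColoring L Z ] ∣ D ∣ ≤ 2 * M * #satisfied (color φ)
        colorStuck = proj₁ colorLow , (begin
          ∣ D ∣                                   ≤⟨ ∣D∣≤2low ⟩
          2 * sum (λ x → 𝟙 (Low? x))              ≤⟨ *-monoʳ-≤ 2 (proj₂ colorLow) ⟩
          2 * (M * #satisfied φ)                  ≡⟨ *-assoc 2 M (#satisfied φ) ⟨
          2 * M * #satisfied φ                    ∎)
          where
          open ≤-Reasoning
          φ = color (proj₁ colorLow)

    -- Deletion of low-degree vertices outside the request.

    module _ (sparse : ∀ Z → sum (λ v → 𝟙 (v ∈? Z) * deg Z v) ≤ d * ∣ Z ∣) where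

      -- Induction on `Z`: the deleted vertex lies outside `D`, so `D` stays inside the smaller set
      -- and coloring that vertex last changes no color on `D`. The degree bound is assumed for
      -- every set because `Z` shrinks.
      colorAbove : ∀ Z → Acc _⊂_ Z → D ⊆ₛ Z →
        Σ[ φ ∈ PartialColoring L Z ] ∣ D ∣ ≤ 2 * M * #satisfied (color φ)
      colorAbove Z (acc rec) D⊆Z
        with any? (λ w → (w ∈? Z) ×-dec (¬? (w ∈? D) ×-dec (deg Z w <? d)))
      ... | no stuck = colorStuck Z D⊆Z (sparse Z) (λ v∈Z v∉D → ≮⇒≥ (λ lt → stuck (_ , v∈Z , v∉D , lt)))
      ... | yes (w , w∈Z , w∉D , lt) with colorAbove (Z - w) (rec (x∈p⇒p-x⊂p w∈Z)) D⊆Z-w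
        where
        D⊆Z-w : D ⊆ₛ Z - w
        D⊆Z-w v∈D = x∈p∧x≢y⇒x∈p-y (D⊆Z v∈D) (λ { refl → w∉D v∈D })
      ... | φ , le with extend w∈Z lt (large w) φ
      ...   | ψ , away = ψ , ≤-trans le (*-monoʳ-≤ (2 * M) (sum-mono still))
        where
        still : ∀ v → 𝟙 (Satisfied? (color φ) v) ≤ 𝟙 (Satisfied? (color ψ) v)
        still v = 𝟙-mono (Satisfied? (color φ) v) (Satisfied? (color ψ) v)
          (λ (v∈D , eq) → v∈D , trans (away v (λ { refl → w∉D v∈D })) eq)

      satisfyMany : Σ[ φ ∈ Coloring G L ] ∣ D ∣ ≤ 2 * M * #satisfied (Coloring.color φ)
      satisfyMany with φ , le ← colorAbove ⊤ (⊂-wellFounded ⊤) (λ _ → ∈⊤) =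
        record { color  = color φ
               ; proper = proper φ ∈⊤ ∈⊤
               ; inList = λ _ → inList φ ∈⊤ } , le

-- Passing between rational and natural inequalities.

/-≤-fromℕ : ∀ a m .{{_ : NonZero m}} e → ℤ.+ a / m ≤ℚ fromℕ e → a ≤ e * m
/-≤-fromℕ a (suc m) e le = ℤ.drop‿+≤+ (subst₂ ℤ._≤_ lhs (sym (ℤ.pos-* e (suc m))) (ℚᵘ.drop-*≤* unnormalised))
  where
  unnormalised : mkℚᵘ (ℤ.+ a) m ≤ᵘ mkℚᵘ (ℤ.+ e) 0
  unnormalised = ℚᵘ.≤-respˡ-≃ (ℚ.toℚᵘ-fromℚᵘ (mkℚᵘ (ℤ.+ a) m))
    (ℚᵘ.≤-respʳ-≃ (ℚ.toℚᵘ-fromℚᵘ (mkℚᵘ (ℤ.+ e) 0)) (ℚ.toℚᵘ-mono-≤ le))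
  lhs : ℤ.+ a ℤ.* ℤ.+ 1 ≡ ℤ.+ a
  lhs = ℤ.*-identityʳ (ℤ.+ a)

1/-*-≤ : ∀ K .{{_ : NonZero K}} a s → a ≤ K * s → (ℤ.+ 1 / K) ℚ.* fromℕ a ≤ℚ fromℕ s
1/-*-≤ (suc K) a s le = ℚ.toℚᵘ-cancel-≤ (begin
  toℚᵘ ((ℤ.+ 1 / suc K) ℚ.* fromℕ a)           ≃⟨ ℚ.toℚᵘ-homo-* (ℤ.+ 1 / suc K) (fromℕ a) ⟩
  toℚᵘ (ℤ.+ 1 / suc K) ℚᵘ.* toℚᵘ (fromℕ a)     ≃⟨ ℚᵘ.*-cong (ℚ.toℚᵘ-fromℚᵘ (mkℚᵘ (ℤ.+ 1) K)) (ℚ.toℚᵘ-fromℚᵘ (mkℚᵘ (ℤ.+ a) 0)) ⟩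
  mkℚᵘ (ℤ.+ 1) K ℚᵘ.* mkℚᵘ (ℤ.+ a) 0             ≤⟨ *≤* (subst₂ ℤ._≤_ lhs rhs (ℤ.+≤+ le)) ⟩
  mkℚᵘ (ℤ.+ s) 0                               ≃⟨ ℚ.toℚᵘ-fromℚᵘ (mkℚᵘ (ℤ.+ s) 0) ⟨
  toℚᵘ (fromℕ s)                             ∎)
  where
  open ℚᵘ.≤-Reasoning
  lhs : ℤ.+ a ≡ (ℤ.+ 1 ℤ.* ℤ.+ a) ℤ.* ℤ.+ 1
  lhs = sym (trans (ℤ.*-identityʳ _) (ℤ.*-identityˡ _))
  rhs : ℤ.+ (suc K * s) ≡ ℤ.+ s ℤ.* (ℤ.+ suc (K * 1))
  rhs = trans (cong ℤ.+_ (trans (*-comm (suc K) s) (cong (λ e → s * suc e) (sym (*-identityʳ K))))) (ℤ.pos-* s _)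

-- The handshake identity makes the degree sum the numerator of the average degree of the induced
-- subgraph. The empty set has no average degree and is treated directly.
sparse : ∀ {G : Graph n} {mad} d → IsMaximumAverageDegree G mad → mad ≤ℚ fromℕ d →
         ∀ Z → sum (λ v → 𝟙 (v ∈? Z) * deg G Z v) ≤ d * ∣ Z ∣
sparse {n} {G} d (bound , _) mad≤d Z = by-cases (∣ Z ∣ ℕ.≟ 0)
  where
  vanish : ∣ Z ∣ ≡ 0 → ∀ v → 𝟙 (v ∈? Z) * deg G Z v ≡ 0
  vanish empty v = cong (_* deg G Z v) (n≤0⇒n≡0 (≤-trans (term≤sum (λ v → 𝟙 (v ∈? Z)) v)
    (≤-reflexive (trans (sym (∣p∣≡sum Z)) empty))))

  by-cases : Dec (∣ Z ∣ ≡ 0) → sum (λ v → 𝟙 (v ∈? Z) * deg G Z v) ≤ d * ∣ Z ∣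
  by-cases (yes empty) =
    ≤-trans (≤-reflexive (trans (sum-cong-≗ (vanish empty)) (trans (sum-const n 0) (*-zeroʳ n)))) z≤n
  by-cases (no nonempty) = ≤-trans (≤-reflexive (handshake G Z))
    (/-≤-fromℕ _ ∣ Z ∣ {{∣Z∣≢0}} d (ℚ.≤-trans (bound (induced G Z) {{∣Z∣≢0}}) mad≤d))
    where
    ∣Z∣≢0 = ≢-nonZero nonempty

-- The constant and the conclusion.

Choosable-mono : ∀ {G : Graph n} {j k} → j ≤ k → Choosable G j → Choosable G k
Choosable-mono j≤k choosable L large = choosable L (λ v → ≤-trans j≤k (large v))

∈-tabulate : ∀ (f : Fin n → _) {v} → f v ≡ true → v ∈ₛ Vec.tabulate f
∈-tabulate f {v} eq = lookup⇒[]= v _ (trans (lookup∘tabulate f v) eq)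

-- This is `2 * M` for `d = suc k`: the factor 2 comes from Markov's inequality, the power from the
-- random choices.
scale : ℕ → ℕ
scale k = 2 * (2 + k) ^ suc (2 * suc k)

scale≢0 : ∀ k → NonZero (scale k)
scale≢0 k = m*n≢0 2 ((2 + k) ^ suc (2 * suc k)) {{_}} {{m^n≢0 (2 + k) (suc (2 * suc k))}}

ε : ℕ → ℚ
ε k = (ℤ.+ 1 / scale k) {{scale≢0 k}}

0<ε : ∀ k → 0ℚ <ℚ ε k
0<ε k = ℚ.positive⁻¹ (ε k) {{ℚ.normalize-pos 1 (scale k) {{scale≢0 k}}}}

flexible : ∀ {G : Graph n} {k} → Choosable G k →
  (∀ Z → sum (λ v → 𝟙 (v ∈? Z) * deg G Z v) ≤ suc k * ∣ Z ∣) →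
  (L : ListAssignment G) → (∀ v → suc k ≤ size (L v)) →
  Flexible (ε k) G L
flexible {n} {G} {k} choosable sparse L large r
  = φ , 1/-*-≤ (scale k) {{scale≢0 k}} ∣ dom ∣ ∣ satisfiedBy φ ∣ enough
  where
  open Request r
  ρ : Fin n → Color
  -- The default `0` need not lie in the list: only vertices of `dom` are ever given their value of
  -- `ρ`.
  ρ v = fromMaybe 0 (request v)

  requested : ∀ {v} → v ∈ₛ dom → request v ≡ just (ρ v)
  requested {v} v∈ with request v | trans (sym (lookup∘tabulate (is-just ∘ request) v)) ([]=⇒lookup v∈)
  ... | just c  | _  = refl
  ... | nothing | ()

  many = satisfyMany G choosable L large dom ρ (λ v∈ → inList _ (requested v∈)) sparse
  φ = proj₁ many

  satisfied : ∀ v → v ∈ₛ dom × Coloring.color φ v ≡ ρ v → v ∈ₛ satisfiedBy φ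
  satisfied v (v∈ , eq) = ∈-tabulate _ (dec-true (Maybe.≡-dec ℕ._≟_ _ _)
    (trans (requested v∈) (cong just (sym eq))))

  enough : ∣ dom ∣ ≤ scale k * ∣ satisfiedBy φ ∣
  enough = ≤-trans (proj₂ many) (*-monoʳ-≤ (scale k)
    (≤-trans (sum-mono (λ v → 𝟙-mono ((v ∈? dom) ×-dec (Coloring.color φ v ℕ.≟ ρ v)) (v ∈? satisfiedBy φ) (satisfied v)))
             (≤-reflexive (sym (∣p∣≡sum (satisfiedBy φ))))))

theorem4 : ∀ (d : ℕ) → 2 ≤ d →
    Σ[ ε ∈ ℚ ] 0ℚ <ℚ ε ×
    (∀ {n : ℕ} (G : Graph n) (mad : ℚ) (ch : ℕ) →
    IsMaximumAverageDegree G mad → mad ≤ℚ fromℕ d →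
    IsChoosability G ch → ch ≤ d ∸ 1 →
    ∀ (L : ListAssignment G) → (∀ v → d ≤ ColorSet.size (L v)) →
    Flexible ε G L)
-- Writing `d` as `suc k` makes `d ∸ 1` compute to `k`; `ε k` depends on `d` alone.
theorem4 (suc k) _ = ε k , 0<ε k , λ G mad ch isMad mad≤d (choosable , _) ch≤k L large →
  flexible (Choosable-mono ch≤k choosable) (sparse (suc k) isMad mad≤d) L large
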